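{- For all integers $n \geq 0$, $|A_{2n+1}(2143)|$ is equal to the number of shifted standard Young tableaux of shape $\langle n+2, n+1, n\rangle$.
   Context: A permutation $w = w_1w_2\cdots w_m$ of length $m$ is a word containing each element of $[m]=\{1,\dots,m\}$ exactly once. It is alternating if $w_1 < w_2 > w_3 < w_4 > \cdots$ (up-down convention); $A_m$ is the set of alternating permutations of length $m$. A permutation $w$ contains the pattern $p = p_1 \cdots p_k \in S_k$ if there are indices $i_1 < \cdots < i_k$ such that $w_{i_\ell} < w_{i_r}$ if and only if $p_\ell < p_r$; otherwise $w$ avoids $p$. $A_m(p)$ is the set of elements of $A_m$ that avoid $p$. For a partition $\lambda = \langle \lambda_1, \lambda_2, \dots\rangle$ with distinct nonzero parts $\lambda_1 > \lambda_2 > \cdots$ (trailing zeroes are ignored), the shifted Young diagram of shape $\lambda$ is the array of boxes in positions (row $i$, column $j$) with $i \le j \le i + \lambda_i - 1$, i.e. row $i$ has $\lambda_i$ boxes and is shifted $i-1$ steps to the right. A shifted standard Young tableau of shape $\lambda$ is a filling of these boxes with $1, 2, \dots, |\lambda|$, where $|\lambda| = \lambda_1 + \lambda_2 + \cdots$, each used exactly once, with entries increasing from left to right along rows and from top to bottom down columns. $|S|$ denotes the size of the set $S$. -}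

module Defs where

open import Data.Fin.Base as Fin using (Fin; toℕ)
open import Data.Fin.Patterns using (0F; 1F; 2F; 3F)
open import Data.Fin.Permutation as Perm using (Permutation′; permutation; _⟨$⟩ʳ_)
open import Data.List.Base using (List; []; _∷_; length; lookup; sum)
open import Data.List.Relation.Unary.Linked using (Linked; [-]; _∷_)
open import Data.Nat.Base using (ℕ; suc; _+_; _<_)
open import Data.Nat.Divisibility using (_∣_)
open import Data.Nat.Properties using (n<1+n)
open import Data.Product.Base using (Σ-syntax; _×_; _,_; proj₁)
open import Data.Sum.Base using (_⊎_; inj₁)
open import Function.Bundles using (_↔_; _⇔_; Inverse)
open import Level using (Level; 0ℓ; _⊔_)
open import Relation.Binary.Bundles using (Setoid)
open import Relation.Binary.PropositionalEquality using (_≡_; refl; sym; trans; setoid)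
open import Relation.Nullary.Negation using (¬_)

-- |S| = k.  Sets are setoids here because permutations and tableaux are
-- functions packaged with proofs: two of them count as the same element when
-- their values agree.
HasSize : ∀ {a ℓ : Level} → Setoid a ℓ → ℕ → Set (a ⊔ ℓ)
HasSize S k = Inverse S (setoid (Fin k))

-- A permutation w of length m is read in one-line notation, position i holding
-- the letter w ⟨$⟩ʳ i.  Positions and letters are numbered from 0, so the odd
-- positions w₁, w₃, … of the usual numbering are the i with 2 ∣ toℕ i.
Alternating : ∀ {m} → Permutation′ m → Set
Alternating {m} w = ∀ (i j : Fin m) → toℕ j ≡ suc (toℕ i) →
  (2 ∣ toℕ i → (w ⟨$⟩ʳ i) Fin.< (w ⟨$⟩ʳ j)) ×
  (¬ (2 ∣ toℕ i) → (w ⟨$⟩ʳ j) Fin.< (w ⟨$⟩ʳ i))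

Contains : ∀ {m k} → Permutation′ m → Permutation′ k → Set
Contains {m} {k} w p = Σ[ i ∈ (Fin k → Fin m) ]
  (∀ (l r : Fin k) → l Fin.< r → i l Fin.< i r) ×
  (∀ (l r : Fin k) →
    ((w ⟨$⟩ʳ i l) Fin.< (w ⟨$⟩ʳ i r)) ⇔ ((p ⟨$⟩ʳ l) Fin.< (p ⟨$⟩ʳ r)))

Avoids : ∀ {m k} → Permutation′ m → Permutation′ k → Set
Avoids w p = ¬ Contains w p

A : ∀ {k} → ℕ → Permutation′ k → Setoid 0ℓ 0ℓ
A m p = record
  { Carrier       = Σ[ w ∈ Permutation′ m ] (Alternating w × Avoids w p)
  ; _≈_           = λ v w → proj₁ v Perm.≈ proj₁ w
  ; isEquivalence = record
    { refl  = λ _ → refl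
    ; sym   = λ v≈w i → sym (v≈w i)
    ; trans = λ u≈v v≈w i → trans (u≈v i) (v≈w i)
    }
  }

p2143 : Permutation′ 4
p2143 = permutation f f f∘f f∘f
  where
  f : Fin 4 → Fin 4
  f 0F = 1F
  f 1F = 0F
  f 2F = 3F
  f 3F = 2F

  f∘f : ∀ i → f (f i) ≡ i
  f∘f 0F = refl
  f∘f 1F = refl
  f∘f 2F = refl
  f∘f 3F = refl

-- A partition with distinct nonzero parts.  The second alternative only serves
-- to permit trailing zeroes.
record StrictPartition : Set where
  field
    parts      : List ℕ
    decreasing : Linked (λ a b → b < a ⊎ b ≡ 0) parts

open StrictPartition public using (parts)

∣_∣ : StrictPartition → ℕ
∣ la ∣ = sum (parts la)

-- The box (i , d) is the one d steps from the left end of row i.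
Box : StrictPartition → Set
Box la = Σ[ i ∈ Fin (length (parts la)) ] Fin (lookup (parts la) i)

row : ∀ la → Box la → ℕ
row la (i , d) = toℕ i

-- Rows and columns are numbered from 0; row i is shifted i steps to the right.
col : ∀ la → Box la → ℕ
col la (i , d) = toℕ i + toℕ d

-- The entries 1, …, |λ| are represented by 0, …, |λ| - 1.
record ShiftedSYT (la : StrictPartition) : Set where
  field
    filling : Box la ↔ Fin ∣ la ∣

  entry : Box la → Fin ∣ la ∣
  entry = Inverse.to filling

  field
    rowsIncrease    : ∀ b c → row la b ≡ row la c → col la b < col la c →
                      entry b Fin.< entry c
    columnsIncrease : ∀ b c → col la b ≡ col la c → row la b < row la c →
                      entry b Fin.< entry c

open ShiftedSYT public using (entry)

shiftedSYT : StrictPartition → Setoid 0ℓ 0ℓ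
shiftedSYT la = record
  { Carrier       = ShiftedSYT la
  ; _≈_           = λ T U → ∀ b → entry T b ≡ entry U b
  ; isEquivalence = record
    { refl  = λ _ → refl
    ; sym   = λ T≈U b → sym (T≈U b)
    ; trans = λ S≈T T≈U b → trans (S≈T b) (T≈U b)
    }
  }

⟨n+2,n+1,n⟩ : ℕ → StrictPartition
⟨n+2,n+1,n⟩ n = record
  { parts      = 2 + n ∷ 1 + n ∷ n ∷ []
  ; decreasing = inj₁ (n<1+n (1 + n)) ∷ inj₁ (n<1+n n) ∷ [-]
  }

{-# OPTIONS --safe #-}
module Submission where

-- Both families grow along the same generating tree.
--
-- An alternating permutation of length 2n+3 arises from one of length 2n+1 by
-- prefixing two letters.  Prefixing v creates a 2143 iff the old permutation has
-- letters a … d … c with a < v ≤ c < d.  After prefixing an ascent x < y, the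
-- admissible slots are the old ones up to x and all those above the old slot of
-- y.  Hence only the number of admissible slots and the number of those above
-- the first letter matter.
--
-- A shifted tableau of shape ⟨n+3,n+2,n+1⟩ arises from one of shape ⟨n+2,n+1,n⟩
-- by adding a column on the right.  Its bottom entry is the largest, and the
-- choices for the other two depend only on how many entries exceed the right
-- ends of the first two rows.
--
-- In both cases the choices are encoded by the pairs (p , q) with q ≤ p, p ≤ p′ + 2
-- and q ≤ q′ + 1, where (p′ , q′) encodes the previous step.

open import Defs
open import Data.Nat.Base using (ℕ; _+_; _*_)
open import Data.Product.Base using (∃-syntax; _×_)
open import Data.Fin.Base as Fin using (Fin; zero; suc; toℕ; fromℕ<; punchIn; opposite; cast)
open import Data.Fin.Patterns using (0F; 1F; 2F; 3F)
open import Data.Fin.Permutation as Perm using (Permutation′; _⟨$⟩ʳ_; _⟨$⟩ˡ_; insert; remove)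
open import Data.Fin.Properties using (toℕ<n; toℕ-fromℕ<; toℕ-injective; toℕ-cast; opposite-prop)
open import Data.List.Base as List using (List; filter; cartesianProductWith; cartesianProduct; upTo)
open import Data.List.Membership.Propositional using (_∈_)
open import Data.List.Membership.Propositional.Properties using (∈-filter⁺; ∈-filter⁻; ∈-lookup; ∈-cartesianProductWith⁺; ∈-cartesianProduct⁺; ∈-upTo⁺)
open import Data.List.Relation.Unary.All as All using ([])
open import Data.List.Relation.Unary.Any as Any using (here)
open import Data.List.Relation.Unary.Any.Properties using (lookup-index)
open import Data.List.Relation.Unary.Unique.Propositional using (Unique; []; _∷_)
open import Data.List.Relation.Unary.Unique.Propositional.Properties using (filter⁺; cartesianProductWith⁺; cartesianProduct⁺; upTo⁺)
open import Data.Nat.Base using (zero; suc; _≤_; _<_; _∸_; z≤n; s≤s; z<s; s≤s⁻¹)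
open import Data.Nat.Divisibility using (_∣_; _∣0; ∣-refl; ∣m+n∣m⇒∣n; ∣m∣n⇒∣m+n; ∣1⇒≡1)
open import Data.Nat.Properties
open import Data.Nat.Solver using (module +-*-Solver)
open import Data.Product.Base using (Σ; _,_; proj₁; proj₂; map₂; uncurry)
open import Data.Sum.Base using (_⊎_; inj₁; inj₂)
open import Data.Unit.Base using (⊤; tt)
open import Data.Vec.Base using (Vec; []; _∷_)
open import Data.Vec.Properties using (∷-injective)
open import Function.Base using (_∘_)
open import Function.Bundles using (Inverse; Equivalence; _↔_; mk⇔; mk↔ₛ′)
open import Function.Construct.Composition as Composition using (_↔-∘_)
open import Function.Construct.Symmetry as Symmetry using (↔-sym)
open import Function.Properties.Bijection using (Bijection⇒Inverse)
open import Level using (Level; 0ℓ)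
open import Relation.Binary.Bundles using (Setoid)
open import Relation.Binary.Definitions using (tri<; tri≈; tri>)
open import Relation.Binary.PropositionalEquality
open import Relation.Nullary using (¬_; yes; no; contradiction)
open import Relation.Nullary.Decidable using (_×-dec_; _⊎-dec_)
open import Relation.Unary using (Pred; Decidable)

Pairs : ℕ → Set
Pairs = Vec (ℕ × ℕ)


-- Counting and ranking the numbers that satisfy a predicate

count : {P : Pred ℕ 0ℓ} → Decidable P → ℕ → ℕ
count P? zero = 0
count P? (suc n) with P? n
... | yes _ = suc (count P? n)
... | no  _ = count P? n

count-cong : {P Q : Pred ℕ 0ℓ} (P? : Decidable P) (Q? : Decidable Q) → ∀ n →
             (∀ {v} → v < n → P v → Q v) → (∀ {v} → v < n → Q v → P v) →
             count P? n ≡ count Q? n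
count-cong P? Q? zero f g = refl
count-cong P? Q? (suc n) f g
  with ih ← count-cong P? Q? n (f ∘ m<n⇒m<1+n) (g ∘ m<n⇒m<1+n)
  with P? n | Q? n
... | yes _ | yes _ = cong suc ih
... | yes p | no ¬q = contradiction (f (n<1+n n) p) ¬q
... | no ¬p | yes q = contradiction (g (n<1+n n) q) ¬p
... | no _  | no _  = ih

module _ {P : Pred ℕ 0ℓ} (P? : Decidable P) where

  count-suc : ∀ {n} → P n → count P? (suc n) ≡ suc (count P? n)
  count-suc {n} p with P? n
  ... | yes _ = refl
  ... | no ¬p = contradiction p ¬p

  count-mono : ∀ {m n} → m ≤ n → count P? m ≤ count P? n
  count-mono {n = zero} z≤n = ≤-refl
  count-mono {m} {suc n} m≤ with m≤n⇒m<n∨m≡n m≤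
  ... | inj₂ refl = ≤-refl
  ... | inj₁ m<1+n with P? n
  ...   | yes _ = m≤n⇒m≤1+n (count-mono (s≤s⁻¹ m<1+n))
  ...   | no  _ = count-mono (s≤s⁻¹ m<1+n)

  count-mono-< : ∀ {m n} → P m → m < n → count P? m < count P? n
  count-mono-< p m<n = ≤-trans (≤-reflexive (sym (count-suc p))) (count-mono m<n)

  count-injective : ∀ {m n} → P m → P n → count P? m ≡ count P? n → m ≡ n
  count-injective {m} {n} p q eq with <-cmp m n
  ... | tri< m<n _ _ = contradiction eq (<⇒≢ (count-mono-< p m<n))
  ... | tri≈ _ m≡n _ = m≡n
  ... | tri> _ _ m>n = contradiction (sym eq) (<⇒≢ (count-mono-< q m>n))

  -- The inverse of ranking: the witness is the element of rank `k` among those satisfying `P`. It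
  -- turns a coordinate of a code back into a letter.
  count-select : ∀ n {k} → k < count P? n → ∃[ x ] (x < n × P x × count P? x ≡ k)
  count-select (suc n) {k} k< with P? n
  ... | no _ = let x , x<n , r = count-select n k< in x , m<n⇒m<1+n x<n , r
  ... | yes p with m≤n⇒m<n∨m≡n (s≤s⁻¹ k<)
  ...   | inj₂ refl = n , n<1+n n , p , refl
  ...   | inj₁ k<′ = let x , x<n , r = count-select n k<′ in x , m<n⇒m<1+n x<n , r

  count-full : ∀ {m n} → m ≤ n → (∀ {v} → m ≤ v → P v) → count P? n ≡ count P? m + (n ∸ m)
  count-full {m} m≤n full with m≤n⇒∃[o]m+o≡n m≤n
  ... | k , refl rewrite m+n∸m≡n m k = go k
    where
    go : ∀ k → count P? (m + k) ≡ count P? m + k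
    go zero = trans (cong (count P?) (+-identityʳ m)) (sym (+-identityʳ _))
    go (suc k) = trans (cong (count P?) (+-suc m k))
      (trans (count-suc (full (m≤m+n m k))) (trans (cong suc (go k)) (sym (+-suc _ k))))

  count-empty : ∀ {m n} → m ≤ n → (∀ {v} → m ≤ v → v < n → ¬ P v) → count P? n ≡ count P? m
  count-empty {n = zero} z≤n empty = refl
  count-empty {m} {suc n} m≤ empty with m≤n⇒m<n∨m≡n m≤
  ... | inj₂ refl = refl
  ... | inj₁ m<1+n with P? n
  ...   | yes p = contradiction p (empty (s≤s⁻¹ m<1+n) (n<1+n n))
  ...   | no  _ = count-empty (s≤s⁻¹ m<1+n) (λ m≤v v<n → empty m≤v (m<n⇒m<1+n v<n))

-- Codes and their enumeration

-- In (p , q) ∷ c the pair (p , q) encodes the last step.  pMax and qMax are the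
-- labels of a node of the generating tree; the root has labels 1 and 0.
pMax : ∀ {n} → Pairs n → ℕ
pMax []            = 1
pMax ((p , q) ∷ c) = 2 + p

qMax : ∀ {n} → Pairs n → ℕ
qMax []            = 0
qMax ((p , q) ∷ c) = suc q

IsCode : ∀ {n} → Pairs n → Set
IsCode []            = ⊤
IsCode ((p , q) ∷ c) = IsCode c × q ≤ qMax c × q ≤ p × p ≤ pMax c

isCode? : ∀ {n} → Decidable (IsCode {n})
isCode? []            = yes tt
isCode? ((p , q) ∷ c) = isCode? c ×-dec (q ≤? qMax c) ×-dec (q ≤? p) ×-dec (p ≤? pMax c)

codes : ℕ → Setoid 0ℓ 0ℓ
codes n = record
  { Carrier       = Σ (Pairs n) IsCode
  ; _≈_           = λ c d → proj₁ c ≡ proj₁ d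
  ; isEquivalence = record { refl = refl ; sym = sym ; trans = trans }
  }

module _ {a b ℓ₁ ℓ₂ : Level} {S : Setoid a ℓ₁} {T : Setoid b ℓ₂} where
  open Setoid S using () renaming (Carrier to X; _≈_ to _≈₁_)
  open Setoid T using () renaming (Carrier to Y; _≈_ to _≈₂_; trans to trans₂)

  -- Each comparison with codes is given as an injective and surjective map; its inverse comes from
  -- the surjectivity witnesses.
  mkInverse : (f : X → Y) → (∀ {x y} → x ≈₁ y → f x ≈₂ f y) → (∀ {x y} → f x ≈₂ f y → x ≈₁ y) →
              (∀ y → ∃[ x ] f x ≈₂ y) → Inverse S T
  mkInverse f cong′ injective surjective = Bijection⇒Inverse record
    { to        = f
    ; cong      = cong′
    ; bijective = injective , λ y → let x , fx≈y = surjective y in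
                                    x , λ z≈x → trans₂ (cong′ z≈x) fx≈y
    }

-- Each step raises the label by at most 2. The bound confines each pair to a finite square, which
-- makes the codes enumerable.
pMax-bound : ∀ {n} (c : Pairs n) → IsCode c → pMax c < 2 + (n + n)
pMax-bound []            _                        = s≤s (s≤s z≤n)
pMax-bound {suc n} ((p , q) ∷ c) (g , _ , _ , p≤) rewrite +-suc n n =
  s≤s (s≤s (≤-trans (s≤s p≤) (pMax-bound c g)))

square : ℕ → List (ℕ × ℕ)
square b = cartesianProduct (upTo b) (upTo b)

allCodes : ∀ n → List (Pairs n)
allCodes zero    = List.[ [] ]
allCodes (suc n) = filter isCode?
  (cartesianProductWith _∷_ (square (2 + (n + n))) (allCodes n))

allCodes-unique : ∀ n → Unique (allCodes n)
allCodes-unique zero    = [] ∷ []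
allCodes-unique (suc n) = filter⁺ isCode?
  (cartesianProductWith⁺ _∷_ ∷-injective (cartesianProduct⁺ (upTo⁺ b) (upTo⁺ b)) (allCodes-unique n))
  where
  b = 2 + (n + n)

allCodes-sound : ∀ n {c} → c ∈ allCodes n → IsCode c
allCodes-sound zero    (here refl) = tt
allCodes-sound (suc n) c∈ = proj₂ (∈-filter⁻ isCode? {xs = cartesianProductWith _∷_ (square (2 + (n + n))) (allCodes n)} c∈)

allCodes-complete : ∀ n {c} → IsCode c → c ∈ allCodes n
allCodes-complete zero    {[]}          _ = here refl
allCodes-complete (suc n) {(p , q) ∷ c} g@(g′ , _ , q≤p , p≤) =
  ∈-filter⁺ isCode? (∈-cartesianProductWith⁺ _∷_
    (∈-cartesianProduct⁺ (∈-upTo⁺ p<) (∈-upTo⁺ (≤-<-trans q≤p p<))) (allCodes-complete n g′)) g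
  where
  p< = ≤-<-trans p≤ (pMax-bound c g′)

lookup-injective : ∀ {a} {X : Set a} {xs : List X} → Unique xs → ∀ {i j} →
                   List.lookup xs i ≡ List.lookup xs j → i ≡ j
lookup-injective (_ ∷ _)  {zero}  {zero}  _  = refl
lookup-injective (x≢ ∷ _) {zero}  {suc j} eq = contradiction eq (All.lookup x≢ (∈-lookup j))
lookup-injective (x≢ ∷ _) {suc i} {zero}  eq = contradiction (sym eq) (All.lookup x≢ (∈-lookup i))
lookup-injective (_ ∷ u)  {suc i} {suc j} eq = cong suc (lookup-injective u eq)

codes-enumeration : ∀ n → Inverse (setoid (Fin (List.length (allCodes n)))) (codes n)
codes-enumeration n = mkInverse {S = setoid _} {T = codes n}
  (λ i → List.lookup (allCodes n) i , allCodes-sound n (∈-lookup i))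
  (cong (List.lookup (allCodes n)))
  (lookup-injective (allCodes-unique n))
  (λ (c , g) → Any.index (allCodes-complete n g) , sym (lookup-index (allCodes-complete n g)))

-- Words, their slots and their codes

-- Recursion makes `oddLength (suc n)` definitionally `2 + oddLength n`, so two letters can be
-- stripped off without casts.
double : ℕ → ℕ
double zero    = 0
double (suc n) = 2 + double n

oddLength : ℕ → ℕ
oddLength n = suc (double n)

-- For the empty word, 0 is the only letter of the permutation of length 1. In general `lastPeak r`
-- stands in for the first letter in the descent condition, see `Describes`.
lastPeak : ∀ {n} → Pairs n → ℕ
lastPeak []            = 0
lastPeak ((x , y) ∷ r) = y

-- The pair (x , y) stands for prefixing first y and then x ≤ y, so that the new
-- permutation begins with x, y + 1.  Slot r v says that prefixing v to the
-- permutation with word r creates no 2143.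
Slot : ∀ {n} → Pairs n → ℕ → Set
Slot []            v = ⊤
Slot ((x , y) ∷ r) v = (v ≤ x × Slot r v) ⊎ y < v

slot? : ∀ {n} (r : Pairs n) → Decidable (Slot r)
slot? []            v = yes tt
slot? ((x , y) ∷ r) v = ((v ≤? x) ×-dec slot? r v) ⊎-dec (y <? v)

slots : ∀ {n} → Pairs n → ℕ → ℕ
slots r = count (slot? r)

-- The condition `lastPeak r < y` does double duty: it forces the descent after the new peak and, by
-- `slot-above`, makes `y` a slot.
IsWord : ∀ {n} → Pairs n → Set
IsWord []                    = ⊤
IsWord {suc n} ((x , y) ∷ r) = IsWord r × x ≤ y × lastPeak r < y × y ≤ oddLength n × Slot r x

slot-above : ∀ {n} (r : Pairs n) {v} → lastPeak r < v → Slot r v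
slot-above []      _ = tt
slot-above (_ ∷ r) y<v = inj₂ y<v

-- For a word, `q` counts the slots of `r` above `y`, and `p` adds to these the slots below `x`.
toCode : ∀ {n} → Pairs n → Pairs n
toCode []                    = []
toCode {suc n} ((x , y) ∷ r) = (slots r x + (oddLength n ∸ y) , oddLength n ∸ y) ∷ toCode r

-- The range splits at `x` and `y`: up to `x` the slots are those of `r`, from there to `y` there
-- are none, and beyond `y` every value is one.
slots-∷ : ∀ {n x y} (r : Pairs n) {m} → x ≤ y → Slot r x → y < m →
          slots ((x , y) ∷ r) m ≡ suc (slots r x) + (m ∸ suc y)
slots-∷ {x = x} {y} r {m} x≤y sx y<m = begin
  slots ((x , y) ∷ r) m                         ≡⟨ count-full (slot? _) y<m inj₂ ⟩
  slots ((x , y) ∷ r) (suc y) + (m ∸ suc y)     ≡⟨ cong (_+ (m ∸ suc y)) (count-empty (slot? _) (s≤s x≤y) gap) ⟩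
  slots ((x , y) ∷ r) (suc x) + (m ∸ suc y)     ≡⟨ cong (_+ (m ∸ suc y)) (count-cong (slot? _) (slot? r) (suc x) old new) ⟩
  slots r (suc x) + (m ∸ suc y)                 ≡⟨ cong (_+ (m ∸ suc y)) (count-suc (slot? r) sx) ⟩
  suc (slots r x) + (m ∸ suc y)                 ∎
  where
  open ≡-Reasoning
  gap : ∀ {v} → x < v → v < suc y → ¬ Slot ((x , y) ∷ r) v
  gap x<v v≤y (inj₁ (v≤x , _)) = <⇒≱ x<v v≤x
  gap x<v v≤y (inj₂ y<v)       = <⇒≱ y<v (s≤s⁻¹ v≤y)
  old : ∀ {v} → v < suc x → Slot ((x , y) ∷ r) v → Slot r v
  old v≤x (inj₁ (_ , s)) = s
  old v≤x (inj₂ y<v)     = contradiction (≤-trans (s≤s⁻¹ v≤x) x≤y) (<⇒≱ y<v)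
  new : ∀ {v} → v < suc x → Slot r v → Slot ((x , y) ∷ r) v
  new v≤x s = inj₁ (s≤s⁻¹ v≤x , s)

-- The slots above the first letter are the values from `lastPeak r + 1` to `oddLength n`; there are
-- `1 + qMax` of them.
qMax-toCode : ∀ {n} (r : Pairs n) → IsWord r → lastPeak r + suc (qMax (toCode r)) ≡ oddLength n
qMax-toCode []                    _                  = refl
qMax-toCode {suc n} ((x , y) ∷ r) (_ , _ , _ , y≤ , _) = begin
  y + (2 + (oddLength n ∸ y)) ≡⟨ +-suc y _ ⟩
  suc (y + suc (oddLength n ∸ y)) ≡⟨ cong suc (+-suc y _) ⟩
  2 + (y + (oddLength n ∸ y)) ≡⟨ cong (2 +_) (m+[n∸m]≡n y≤) ⟩
  2 + oddLength n             ∎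
  where open ≡-Reasoning

-- A letter prefixed to a permutation of length `oddLength n` ranges over `suc (oddLength n)`
-- values, so the left side is the total number of slots.
pMax-toCode : ∀ {n} (r : Pairs n) → IsWord r → slots r (suc (oddLength n)) ≡ suc (pMax (toCode r))
pMax-toCode []                    _                       = refl
pMax-toCode {suc n} ((x , y) ∷ r) (_ , x≤y , _ , y≤ , sx) = begin
  slots ((x , y) ∷ r) (3 + oddLength n)       ≡⟨ slots-∷ r x≤y sx (m≤n⇒m≤o+n 2 (s≤s y≤)) ⟩
  suc (slots r x) + (2 + oddLength n ∸ y)     ≡⟨ cong (suc (slots r x) +_) (+-∸-assoc 2 y≤) ⟩
  suc (slots r x) + (2 + (oddLength n ∸ y))   ≡⟨ cong suc (+-suc (slots r x) _) ⟩
  2 + (slots r x + suc (oddLength n ∸ y))     ≡⟨ cong (2 +_) (+-suc (slots r x) _) ⟩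
  3 + (slots r x + (oddLength n ∸ y))         ∎
  where open ≡-Reasoning

-- All values from `y` on are slots, so the left side is one less than the total. It is the `p`
-- obtained for `x = y`, hence the maximum over `x ≤ y`.
slots-above : ∀ {n} (r : Pairs n) → IsWord r → ∀ {y} → lastPeak r < y → y ≤ oddLength n →
              slots r y + (oddLength n ∸ y) ≡ pMax (toCode r)
slots-above {n} r g {y} <y y≤ = suc-injective (begin
  suc (slots r y + (oddLength n ∸ y))    ≡⟨ +-suc (slots r y) _ ⟨
  slots r y + suc (oddLength n ∸ y)      ≡⟨ cong (slots r y +_) (+-∸-assoc 1 y≤) ⟨
  slots r y + (suc (oddLength n) ∸ y)    ≡⟨ count-full (slot? r) (m≤n⇒m≤1+n y≤) (λ y≤v → slot-above r (<-≤-trans <y y≤v)) ⟨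
  slots r (suc (oddLength n))            ≡⟨ pMax-toCode r g ⟩
  suc (pMax (toCode r))                  ∎)
  where open ≡-Reasoning

toCode-isCode : ∀ {n} (r : Pairs n) → IsWord r → IsCode (toCode r)
toCode-isCode []                    _                              = tt
toCode-isCode {suc n} ((x , y) ∷ r) (g , x≤y , peak<y , y≤ , sx) =
  toCode-isCode r g , q≤ , m≤n+m _ _ ,
  ≤-trans (+-monoˡ-≤ _ (count-mono (slot? r) x≤y)) (≤-reflexive (slots-above r g peak<y y≤))
  where
  q≤ : oddLength n ∸ y ≤ qMax (toCode r)
  q≤ = ≤-trans (∸-monoʳ-≤ (oddLength n) peak<y) (≤-reflexive (begin
    oddLength n ∸ suc (lastPeak r)                                  ≡⟨ cong (_∸ suc (lastPeak r)) (trans (sym (qMax-toCode r g)) (+-suc (lastPeak r) _)) ⟩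
    (lastPeak r + qMax (toCode r)) ∸ lastPeak r                     ≡⟨ m+n∸m≡n (lastPeak r) _ ⟩
    qMax (toCode r)                                                 ∎))
    where open ≡-Reasoning

-- The coordinate `q` determines `y`, and then `p - q` is the rank of `x` among the slots of `r`.
toCode-injective : ∀ {n} (r s : Pairs n) → IsWord r → IsWord s → toCode r ≡ toCode s → r ≡ s
toCode-injective [] [] _ _ _ = refl
toCode-injective ((x , y) ∷ r) ((x′ , y′) ∷ s) (g , _ , _ , y≤ , sx) (h , _ , _ , y′≤ , sx′) eq
  with eq₁ , eq₂ ← ∷-injective eq
  with refl ← toCode-injective r s g h eq₂
  with refl ← ∸-cancelˡ-≡ y≤ y′≤ (cong proj₂ eq₁)
  with refl ← count-injective (slot? r) sx sx′ (+-cancelʳ-≡ _ _ _ (cong proj₁ eq₁)) = refl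

toCode-surjective : ∀ {n} (c : Pairs n) → IsCode c → ∃[ r ] (IsWord r × toCode r ≡ c)
toCode-surjective [] _ = [] , tt , refl
toCode-surjective {suc n} ((p , q) ∷ c) (g , q≤ , q≤p , p≤)
  with r , h , refl ← toCode-surjective c g = (x , y) ∷ r ,
    (h , s≤s⁻¹ x<1+y , peak<y , y≤ , sx) ,
    cong (_∷ toCode r) (cong₂ _,_ (trans (cong₂ _+_ x≡ q≡) (m∸n+n≡m q≤p)) q≡)
  where
  q<N : q < oddLength n
  q<N = ≤-trans (s≤s q≤) (≤-trans (m≤n+m _ (lastPeak r)) (≤-reflexive (qMax-toCode r h)))
  y = oddLength n ∸ q
  y≤ : y ≤ oddLength n
  y≤ = m∸n≤m _ q
  q≡ : oddLength n ∸ y ≡ q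
  q≡ = m∸[m∸n]≡n (<⇒≤ q<N)
  peak<y : lastPeak r < y
  peak<y = m+n≤o⇒m≤o∸n (suc (lastPeak r)) (≤-trans (s≤s (+-monoʳ-≤ (lastPeak r) q≤))
    (≤-reflexive (trans (sym (+-suc (lastPeak r) _)) (qMax-toCode r h))))
  -- From `p ≤ pMax` follows `p ∸ q ≤ slots r y`, and `y` is a slot itself; so the slot of rank
  -- `p ∸ q` is at most `y`.
  bound : p ∸ q < slots r (suc y)
  bound = ≤-trans
    (s≤s (m≤n+o⇒m∸n≤o p q (≤-trans p≤ (≤-reflexive (trans (sym (slots-above r h peak<y y≤))
      (trans (cong (slots r y +_) q≡) (+-comm (slots r y) q)))))))
    (≤-reflexive (sym (count-suc (slot? r) (slot-above r peak<y))))
  selected = count-select (slot? r) (suc y) bound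
  x = proj₁ selected
  x<1+y = proj₁ (proj₂ selected)
  sx = proj₁ (proj₂ (proj₂ selected))
  x≡ = proj₂ (proj₂ (proj₂ selected))

-- Prefixing a letter in one-line notation

-- The relabelling of the old letters when `v` is prefixed: this is `punchIn` on natural numbers,
-- where letters of permutations of different lengths can be compared.
up : ℕ → ℕ → ℕ
up zero    c       = suc c
up (suc v) zero    = zero
up (suc v) (suc c) = suc (up v c)

toℕ-punchIn : ∀ {n} (v : Fin (suc n)) (c : Fin n) → toℕ (punchIn v c) ≡ up (toℕ v) (toℕ c)
toℕ-punchIn zero    c       = refl
toℕ-punchIn (suc v) zero    = refl
toℕ-punchIn (suc v) (suc c) = cong suc (toℕ-punchIn v c)

up-mono-< : ∀ v {c d} → c < d → up v c < up v d
up-mono-< zero    c<d                 = s≤s c<d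
up-mono-< (suc v) {zero}  {suc d} c<d = z<s
up-mono-< (suc v) {suc c} {suc d} c<d = s≤s (up-mono-< v (s≤s⁻¹ c<d))

up-cancel-< : ∀ v {c d} → up v c < up v d → c < d
up-cancel-< zero    c<d                 = s≤s⁻¹ c<d
up-cancel-< (suc v) {zero}  {suc d} c<d = z<s
up-cancel-< (suc v) {suc c} {suc d} c<d = s≤s (up-cancel-< v (s≤s⁻¹ c<d))

up-injective : ∀ v {c d} → up v c ≡ up v d → c ≡ d
up-injective zero                    eq = suc-injective eq
up-injective (suc v) {zero}  {zero}  eq = refl
up-injective (suc v) {suc c} {suc d} eq = cong suc (up-injective v (suc-injective eq))

up-lower : ∀ v {c} → c < v → up v c ≡ c
up-lower (suc v) {zero}  _   = refl
up-lower (suc v) {suc c} c<v = cong suc (up-lower v (s≤s⁻¹ c<v))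

up-upper : ∀ v {c} → v ≤ c → up v c ≡ suc c
up-upper zero            _   = refl
up-upper (suc v) {suc c} v≤c = cong suc (up-upper v (s≤s⁻¹ v≤c))

up-≥ : ∀ v c → c ≤ up v c
up-≥ zero    c       = n≤1+n c
up-≥ (suc v) zero    = z≤n
up-≥ (suc v) (suc c) = s≤s (up-≥ v c)

up-≤ : ∀ v c → up v c ≤ suc c
up-≤ zero    c       = ≤-refl
up-≤ (suc v) zero    = z≤n
up-≤ (suc v) (suc c) = s≤s (up-≤ v c)

up-<⁺ : ∀ {v c t} → t ≤ v → c < t → up v c < t
up-<⁺ {v} t≤v c<t rewrite up-lower v (<-≤-trans c<t t≤v) = c<t

up-<⁻ : ∀ {v c t} → up v c < t → c < t
up-<⁻ {v} {c} = ≤-<-trans (up-≥ v c)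

up->⁺ : ∀ {v c t} → v ≤ t → t ≤ c → t < up v c
up->⁺ {v} v≤t t≤c rewrite up-upper v (≤-trans v≤t t≤c) = s≤s t≤c

up->⁻ : ∀ {v c t} → t < up v c → t ≤ c
up->⁻ {v} {c} t< = s≤s⁻¹ (≤-trans t< (up-≤ v c))

up-≥⁺ : ∀ {v c t} → t ≤ c → t ≤ up v c
up-≥⁺ {v} {c} t≤c = ≤-trans t≤c (up-≥ v c)

up-≥⁻ : ∀ {v c t} → t ≤ v → t ≤ up v c → t ≤ c
up-≥⁻ t≤v t≤ = ≮⇒≥ λ c<t → <⇒≱ (up-<⁺ t≤v c<t) t≤

infixr 5 _◂_
_◂_ : ∀ {m} → ℕ → (Fin m → ℕ) → Fin (suc m) → ℕ
(v ◂ f) zero    = v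
(v ◂ f) (suc i) = up v (f i)

◂-cong : ∀ {m} v {f g : Fin m → ℕ} → f ≗ g → v ◂ f ≗ v ◂ g
◂-cong v f≗g zero    = refl
◂-cong v f≗g (suc i) = cong (up v) (f≗g i)

val : ∀ {m} → Permutation′ m → Fin m → ℕ
val w i = toℕ (w ⟨$⟩ʳ i)

val-surjective : ∀ {m} (w : Permutation′ m) {v} → v < m → ∃[ i ] val w i ≡ v
val-surjective w v<m = w ⟨$⟩ˡ fromℕ< v<m ,
  trans (cong toℕ (Perm.inverseʳ w)) (toℕ-fromℕ< v<m)

hd : ∀ {m} → Permutation′ (suc m) → ℕ
hd w = val w zero

hd≤ : ∀ {m} (w : Permutation′ (suc m)) → hd w ≤ m
hd≤ w = s≤s⁻¹ (toℕ<n (w ⟨$⟩ʳ zero))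

tl : ∀ {m} → Permutation′ (suc m) → Permutation′ m
tl = remove zero

-- Removing the first letter standardises the others, so prefixing it again restores the
-- permutation. This carries the arguments about `_◂_` over to permutations.
val-◂ : ∀ {m} (w : Permutation′ (suc m)) → val w ≗ hd w ◂ val (tl w)
val-◂ w zero    = refl
val-◂ w (suc i) = trans (cong toℕ (Perm.punchIn-permute w zero i)) (toℕ-punchIn (w ⟨$⟩ʳ zero) _)

ext : ∀ {m} (u w : Permutation′ (suc m)) → hd u ≡ hd w → val (tl u) ≗ val (tl w) → val u ≗ val w
ext u w hd≡ tl≡ i = trans (val-◂ u i) (trans (cong (λ v → (v ◂ val (tl u)) i) hd≡)
  (trans (◂-cong (hd w) tl≡ i) (sym (val-◂ w i))))

tl-cong : ∀ {m} (u w : Permutation′ (suc m)) → val u ≗ val w → val (tl u) ≗ val (tl w)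
tl-cong u w eq i = up-injective (hd w) (trans (cong (λ v → up v (val (tl u) i)) (sym (eq zero)))
  (trans (sym (val-◂ u (suc i))) (trans (eq (suc i)) (val-◂ w (suc i)))))

cons : ∀ {m v} → v ≤ m → Permutation′ m → Permutation′ (suc m)
cons v≤m w = insert zero (fromℕ< (s≤s v≤m)) w

hd-cons : ∀ {m v} (v≤m : v ≤ m) w → hd (cons v≤m w) ≡ v
hd-cons v≤m w = toℕ-fromℕ< (s≤s v≤m)

tl-cons : ∀ {m v} (v≤m : v ≤ m) w → val (tl (cons v≤m w)) ≗ val w
tl-cons v≤m w i = cong toℕ (Perm.remove-insert zero (fromℕ< (s≤s v≤m)) w i)

val-cons : ∀ {m v} (v≤m : v ≤ m) w → val (cons v≤m w) ≗ v ◂ val w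
val-cons v≤m w i = trans (val-◂ (cons v≤m w) i) (trans (cong (λ v → (v ◂ val (tl (cons v≤m w))) i) (hd-cons v≤m w))
  (◂-cong _ (tl-cons v≤m w) i))

-- Occurrences of 2143

-- `Alt`, `Occurs` and `Std` are built from strict inequalities between values, so they pass along
-- any change of values that keeps these, such as applying or undoing `up v`.
_⊑_ : ∀ {m} → (Fin m → ℕ) → (Fin m → ℕ) → Set
f ⊑ g = ∀ i j → f i < f j → g i < g j

≗⇒⊑ : ∀ {m} {f g : Fin m → ℕ} → f ≗ g → f ⊑ g
≗⇒⊑ eq i j lt = subst₂ _<_ (eq i) (eq j) lt

≗⇒⊒ : ∀ {m} {f g : Fin m → ℕ} → f ≗ g → g ⊑ f
≗⇒⊒ eq = ≗⇒⊑ (λ i → sym (eq i))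

Alt : ∀ {m} → (Fin m → ℕ) → Set
Alt {m} f = ∀ (i j : Fin m) → toℕ j ≡ suc (toℕ i) → (2 ∣ toℕ i → f i < f j) × (¬ (2 ∣ toℕ i) → f j < f i)

Alt-⊑ : ∀ {m} {f g : Fin m → ℕ} → f ⊑ g → Alt f → Alt g
Alt-⊑ f⊑g alt i j eq = let up , down = alt i j eq in (λ e → f⊑g i j (up e)) , (λ o → f⊑g j i (down o))

Occurs : ∀ {m} → (Fin m → ℕ) → Set
Occurs {m} f = ∃[ i ] ∃[ j ] ∃[ k ] ∃[ l ]
  (i Fin.< j × j Fin.< k × k Fin.< l) × (f j < f i × f i < f l × f l < f k)

Occurs-⊑ : ∀ {m} {f g : Fin m → ℕ} → f ⊑ g → Occurs f → Occurs g
Occurs-⊑ f⊑g (i , j , k , l , pos , ji , il , lk) = i , j , k , l , pos , f⊑g j i ji , f⊑g i l il , f⊑g l k lk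

-- Prefixing v to f would create a 2143 in which v plays the 2.
Blocked : ∀ {m} → (Fin m → ℕ) → ℕ → Set
Blocked f v = ∃[ i ] ∃[ j ] ∃[ k ] (i Fin.< j × j Fin.< k) × (f i < v × v ≤ f k × f k < f j)

Blocked-≗ : ∀ {m} {f g : Fin m → ℕ} → f ≗ g → ∀ {v} → Blocked f v → Blocked g v
Blocked-≗ eq (i , j , k , pos , iv , vk , kj) =
  i , j , k , pos , subst (_< _) (eq i) iv , subst (_ ≤_) (eq k) vk , ≗⇒⊑ eq k j kj

-- The prefixed letter can only come first in an occurrence, so it plays the 2 or does not take
-- part.
Occurs-◂⁻ : ∀ {m} {f : Fin m → ℕ} {v} → Occurs (v ◂ f) → Occurs f ⊎ Blocked f v
Occurs-◂⁻ {v = v} (zero , suc j , suc k , suc l , (_ , jk , kl) , jv , vl , lk) =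
  inj₂ (j , k , l , (s≤s⁻¹ jk , s≤s⁻¹ kl) , up-<⁻ {v} jv , up->⁻ {v} vl , up-cancel-< v lk)
Occurs-◂⁻ {v = v} (suc i , suc j , suc k , suc l , (ij , jk , kl) , ji , il , lk) =
  inj₁ (i , j , k , l , (s≤s⁻¹ ij , s≤s⁻¹ jk , s≤s⁻¹ kl) , up-cancel-< v ji , up-cancel-< v il , up-cancel-< v lk)

Occurs-◂⁺ : ∀ {m} {f : Fin m → ℕ} {v} → Occurs f ⊎ Blocked f v → Occurs (v ◂ f)
Occurs-◂⁺ {v = v} (inj₁ (i , j , k , l , (ij , jk , kl) , ji , il , lk)) =
  suc i , suc j , suc k , suc l , (s≤s ij , s≤s jk , s≤s kl) , up-mono-< v ji , up-mono-< v il , up-mono-< v lk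
Occurs-◂⁺ {v = v} (inj₂ (j , k , l , (jk , kl) , jv , vl , lk)) =
  zero , suc j , suc k , suc l , (z<s , s≤s jk , s≤s kl) , up-<⁺ ≤-refl jv , up->⁺ ≤-refl vl , up-mono-< v lk

Blocked-◂⁺ : ∀ {m} {f : Fin m → ℕ} {x v} → v ≤ x → Blocked f v → Blocked (x ◂ f) v
Blocked-◂⁺ {x = x} v≤x (i , j , k , (ij , jk) , iv , vk , kj) =
  suc i , suc j , suc k , (s≤s ij , s≤s jk) , up-<⁺ v≤x iv , up-≥⁺ {x} vk , up-mono-< x kj

-- With `v ≤ x` the letter `x` is too large to play the 1, so the three blocking letters lie in `f`.
Blocked-◂⁻ : ∀ {m} {f : Fin m → ℕ} {x v} → v ≤ x → Blocked (x ◂ f) v → Blocked f v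
Blocked-◂⁻ v≤x (zero , _ , _ , _ , x<v , _ , _) = contradiction v≤x (<⇒≱ x<v)
Blocked-◂⁻ {x = x} v≤x (suc i , suc j , suc k , (ij , jk) , iv , vk , kj) =
  i , j , k , (s≤s⁻¹ ij , s≤s⁻¹ jk) , up-<⁻ {x} iv , up-≥⁻ v≤x vk , up-cancel-< x kj

module _ {m : ℕ} {f : Fin (suc m) → ℕ} {x y : ℕ} where

  private
    u : Fin (3 + m) → ℕ
    u = x ◂ y ◂ f

  Alt-◂◂⁻ : Alt u → x ≤ y × f zero < y × Alt f
  Alt-◂◂⁻ alt =
    up->⁻ {x} (proj₁ (alt 0F 1F refl) (2 ∣0)) ,
    up-<⁻ {y} (up-cancel-< x (proj₂ (alt 1F 2F refl) λ 2∣1 → contradiction (∣1⇒≡1 2∣1) λ ())) ,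
    λ i j eq → let asc , desc = alt (suc (suc i)) (suc (suc j)) (cong (2 +_) eq) in
      (λ e → cancel (asc (∣m∣n⇒∣m+n ∣-refl e))) ,
      (λ o → cancel (desc (λ e → o (∣m+n∣m⇒∣n e ∣-refl))))
    where
    cancel : ∀ {c d} → up x (up y c) < up x (up y d) → c < d
    cancel = up-cancel-< y ∘ up-cancel-< x

  Alt-◂◂⁺ : x ≤ y → f zero < y → Alt f → Alt u
  Alt-◂◂⁺ x≤y f0<y alt zero (suc zero) _ = (λ _ → up->⁺ ≤-refl x≤y) , (λ o → contradiction (2 ∣0) o)
  Alt-◂◂⁺ x≤y f0<y alt (suc zero) (suc (suc zero)) _ =
    (λ e → contradiction (∣1⇒≡1 e) λ ()) , (λ _ → up-mono-< x (up-<⁺ ≤-refl f0<y))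
  Alt-◂◂⁺ x≤y f0<y alt (suc (suc i)) (suc (suc j)) eq =
    let asc , desc = alt i j (suc-injective (suc-injective eq)) in
    (λ e → mono (asc (∣m+n∣m⇒∣n e ∣-refl))) ,
    (λ o → mono (desc (λ e → o (∣m∣n⇒∣m+n ∣-refl e))))
    where
    mono : ∀ {c d} → c < d → up x (up y c) < up x (up y d)
    mono = up-mono-< x ∘ up-mono-< y

  -- Since `x ≤ y`, the letter `y` has no influence on whether `x` is blocked; both can be tested
  -- against `f`.
  Occurs-◂◂⁻ : x ≤ y → Occurs u → Occurs f ⊎ Blocked f x ⊎ Blocked f y
  Occurs-◂◂⁻ x≤y o with Occurs-◂⁻ {v = x} o
  ... | inj₂ b = inj₂ (inj₁ (Blocked-◂⁻ x≤y b))
  ... | inj₁ o′ with Occurs-◂⁻ {v = y} o′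
  ...   | inj₁ o″ = inj₁ o″
  ...   | inj₂ b  = inj₂ (inj₂ b)

  Occurs-◂◂⁺ : x ≤ y → Occurs f ⊎ Blocked f x ⊎ Blocked f y → Occurs u
  Occurs-◂◂⁺ x≤y (inj₁ o)        = Occurs-◂⁺ {v = x} (inj₁ (Occurs-◂⁺ {v = y} (inj₁ o)))
  Occurs-◂◂⁺ x≤y (inj₂ (inj₁ b)) = Occurs-◂⁺ {v = x} (inj₂ (Blocked-◂⁺ x≤y b))
  Occurs-◂◂⁺ x≤y (inj₂ (inj₂ b)) = Occurs-◂⁺ {v = x} (inj₁ (Occurs-◂⁺ {v = y} (inj₂ b)))

  -- The first letter of `f` is below `y` and would play the 1 in front of any inversion among the
  -- letters from `y` on.
  no-inversion-above : f zero < y → ¬ Blocked f y → ∀ {j k} → j Fin.< k → y ≤ f k → ¬ (f k < f j)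
  no-inversion-above f0<y ok {zero}  jk yk kj = <⇒≱ (<-trans kj f0<y) yk
  no-inversion-above f0<y ok {suc j} jk yk kj = ok (zero , suc j , _ , (z<s , jk) , f0<y , yk , kj)

  free-low : x ≤ y → ∀ {v} → v ≤ x → ¬ Blocked f v → ¬ Blocked u v
  free-low x≤y v≤x ok b = ok (Blocked-◂⁻ (≤-trans v≤x x≤y) (Blocked-◂⁻ v≤x b))

  blocked-low : x ≤ y → ∀ {v} → v ≤ x → Blocked f v → Blocked u v
  blocked-low x≤y v≤x b = Blocked-◂⁺ v≤x (Blocked-◂⁺ (≤-trans v≤x x≤y) b)

  -- For x < v ≤ y the letters x, y + 1, y form the offending pattern.
  blocked-middle : (0 < y → ∃[ k ] suc (f k) ≡ y) → ∀ {v} → x < v → v ≤ y → Blocked u v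
  blocked-middle pred-y {suc v} x<v v<y with pred-y (≤-trans z<s v<y)
  ... | k , refl = zero , suc zero , suc (suc k) , (z<s , s≤s z<s) , x<v ,
    up->⁺ (s≤s⁻¹ x<v) (up-≥⁺ {y} (s≤s⁻¹ v<y)) , up-mono-< x (up-<⁺ ≤-refl (n<1+n (f k)))

  -- The letters playing 4 and 3 would be at least `y + 1`. If the 4 is the peak, which equals
  -- `y + 1`, no such 3 is smaller; otherwise they form an inversion of `f` excluded by
  -- `no-inversion-above`.
  free-high : x ≤ y → f zero < y → ¬ Blocked f y → ∀ {v} → y < v → ¬ Blocked u v
  free-high x≤y f0<y ok {suc v} y<v (_ , suc zero , suc zero , (_ , s≤s ()) , _)
  free-high x≤y f0<y ok {suc v} y<v (_ , suc (suc j) , suc zero , (_ , s≤s ()) , _)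
  free-high x≤y f0<y ok {suc v} y<v (_ , suc zero , suc (suc k) , _ , _ , vk , kj) =
    <⇒≱ (up-cancel-< x kj) (≤-trans (s≤s⁻¹ y<v) (up->⁻ {x} vk))
  free-high x≤y f0<y ok {suc v} y<v (_ , suc (suc j) , suc (suc k) , (_ , jk) , _ , vk , kj) =
    no-inversion-above f0<y ok (s≤s⁻¹ (s≤s⁻¹ jk))
      (up-≥⁻ {y} ≤-refl (≤-trans (s≤s⁻¹ y<v) (up->⁻ {x} vk)))
      (up-cancel-< y (up-cancel-< x kj))

Contains⇒Occurs : ∀ {m} (w : Permutation′ m) → Contains w p2143 → Occurs (val w)
Contains⇒Occurs w (i , mono , iso) =
  i 0F , i 1F , i 2F , i 3F ,
  (mono 0F 1F (s≤s z≤n) , mono 1F 2F (s≤s (s≤s z≤n)) , mono 2F 3F (s≤s (s≤s (s≤s z≤n)))) ,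
  (from (iso 1F 0F) (s≤s z≤n) , from (iso 0F 3F) (s≤s (s≤s z≤n)) , from (iso 3F 2F) (s≤s (s≤s (s≤s z≤n))))
  where open Equivalence using (from)

increasing : ∀ {m} (f : Fin 4 → Fin m) → f 0F Fin.< f 1F → f 1F Fin.< f 2F → f 2F Fin.< f 3F →
             ∀ a b → a Fin.< b → f a Fin.< f b
increasing f ab bc cd 1F            1F (s≤s ())
increasing f ab bc cd (suc (suc a)) 1F (s≤s ())
increasing f ab bc cd (suc (suc a)) 2F (s≤s (s≤s ()))
increasing f ab bc cd (suc (suc (suc a))) 3F (s≤s (s≤s (s≤s ())))
increasing f ab bc cd 0F 1F _ = ab
increasing f ab bc cd 0F 2F _ = <-trans ab bc
increasing f ab bc cd 0F 3F _ = <-trans ab (<-trans bc cd)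
increasing f ab bc cd 1F 2F _ = bc
increasing f ab bc cd 1F 3F _ = <-trans bc cd
increasing f ab bc cd 2F 3F _ = cd

Occurs⇒Contains : ∀ {m} (w : Permutation′ m) → Occurs (val w) → Contains w p2143
Occurs⇒Contains {m} w (i , j , k , l , (ij , jk , kl) , (ji , il , lk)) =
  pos , increasing pos ij jk kl , λ a b → mk⇔ (reflects a b) (preserves a b)
  where
  pos : Fin 4 → Fin m
  pos 0F = i
  pos 1F = j
  pos 2F = k
  pos 3F = l

  -- As 2143 is an involution, `sorted a` is the letter of rank `a` in the occurrence; `ji`, `il`
  -- and `lk` say that these increase.
  sorted : Fin 4 → Fin m
  sorted a = w ⟨$⟩ʳ pos (p2143 ⟨$⟩ʳ a)

  preserves : ∀ a b → (p2143 ⟨$⟩ʳ a) Fin.< (p2143 ⟨$⟩ʳ b) → (w ⟨$⟩ʳ pos a) Fin.< (w ⟨$⟩ʳ pos b)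
  preserves a b lt = subst₂ (λ c d → (w ⟨$⟩ʳ pos c) Fin.< (w ⟨$⟩ʳ pos d)) (Perm.inverseˡ p2143) (Perm.inverseˡ p2143)
    (increasing sorted ji il lk (p2143 ⟨$⟩ʳ a) (p2143 ⟨$⟩ʳ b) lt)

  reflects : ∀ a b → (w ⟨$⟩ʳ pos a) Fin.< (w ⟨$⟩ʳ pos b) → (p2143 ⟨$⟩ʳ a) Fin.< (p2143 ⟨$⟩ʳ b)
  reflects a b lt with <-cmp (toℕ (p2143 ⟨$⟩ʳ a)) (toℕ (p2143 ⟨$⟩ʳ b))
  ... | tri< a<b _ _ = a<b
  ... | tri> _ _ b<a = contradiction lt (<-asym (preserves b a b<a))
  ... | tri≈ _ a≡b _ = contradiction lt (<-irrefl (cong (toℕ ∘ (w ⟨$⟩ʳ_) ∘ pos)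
    (trans (sym (Perm.inverseˡ p2143)) (trans (cong (p2143 ⟨$⟩ˡ_) (toℕ-injective a≡b)) (Perm.inverseˡ p2143)))))

-- The letter `y - 1` of the old permutation becomes the `y` that plays the 3 in `blocked-middle`.
pred-attained : ∀ {m} (w : Permutation′ m) {y} → y ≤ m → 0 < y → ∃[ k ] suc (val w k) ≡ y
pred-attained w {suc y} y<m _ = let k , eq = val-surjective w y<m in k , cong suc eq

-- Permutations avoiding 2143 and their words

Valid : ∀ {m} → (Fin m → ℕ) → Set
Valid f = Alt f × ¬ Occurs f

val-◂◂ : ∀ {m} (w : Permutation′ (2 + m)) → val w ≗ hd w ◂ hd (tl w) ◂ val (tl (tl w))
val-◂◂ w i = trans (val-◂ w i) (◂-cong (hd w) (val-◂ (tl w)) i)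

Valid-≗ : ∀ {m} {f g : Fin m → ℕ} → f ≗ g → Valid f → Valid g
Valid-≗ eq (alt , avoid) = Alt-⊑ (≗⇒⊑ eq) alt , λ o → avoid (Occurs-⊑ (≗⇒⊒ eq) o)

toWord : ∀ n → Permutation′ (oddLength n) → Pairs n
toWord zero    w = []
toWord (suc n) w = (hd w , hd (tl w)) ∷ toWord n (tl (tl w))

-- The induction invariant. By its last two fields no slot exceeds the first letter without
-- exceeding `lastPeak r`, so for a slot `y` the descent `f zero < y` amounts to `lastPeak r < y`.
record Describes {n} (r : Pairs n) (f : Fin (oddLength n) → ℕ) : Set where
  field
    isWord      : IsWord r
    free        : ∀ {v} → Slot r v → ¬ Blocked f v
    slot        : ∀ {v} → ¬ Blocked f v → Slot r v
    start≤peak  : f zero ≤ lastPeak r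
    peak<slot   : ∀ {v} → f zero < v → Slot r v → lastPeak r < v

Describes-≗ : ∀ {n} {r : Pairs n} {f g} → f ≗ g → Describes r f → Describes r g
Describes-≗ {g = g} eq d = record
  { isWord     = isWord
  ; free       = λ s b → free s (Blocked-≗ (sym ∘ eq) b)
  ; slot       = λ ok → slot (λ b → ok (Blocked-≗ eq b))
  ; start≤peak = subst (_≤ _) (eq zero) start≤peak
  ; peak<slot  = λ {v} g0<v → peak<slot (subst (_< v) (sym (eq zero)) g0<v)
  }
  where open Describes d

-- The recursion of `Slot` is checked on three ranges: `free-low` and `blocked-low` up to `x`,
-- `blocked-middle` up to `y`, `free-high` beyond.
Describes-∷ : ∀ {n} {r : Pairs n} {f x y} → y ≤ oddLength n → (0 < y → ∃[ k ] suc (f k) ≡ y) →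
              Valid (x ◂ y ◂ f) → (Valid f → Describes r f) → Describes ((x , y) ∷ r) (x ◂ y ◂ f)
Describes-∷ {n} {r} {f} {x} {y} y≤ pred-y (alt , avoid) describes = record
  { isWord     = isWord , x≤y , peak<slot f0<y (slot y-free) , y≤ , slot x-free
  ; free       = λ where
      (inj₁ (v≤x , s)) → free-low x≤y v≤x (free s)
      (inj₂ y<v)       → free-high x≤y f0<y y-free y<v
  ; slot       = λ {v} → slot′ v
  ; start≤peak = x≤y
  ; peak<slot  = λ where
      x<v (inj₁ (v≤x , _)) → contradiction v≤x (<⇒≱ x<v)
      x<v (inj₂ y<v)       → y<v
  }
  where
  split = Alt-◂◂⁻ {f = f} alt
  x≤y = proj₁ split
  f0<y = proj₁ (proj₂ split)
  x-free : ¬ Blocked f x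
  x-free b = avoid (Occurs-◂◂⁺ x≤y (inj₂ (inj₁ b)))
  y-free : ¬ Blocked f y
  y-free b = avoid (Occurs-◂◂⁺ x≤y (inj₂ (inj₂ b)))
  open Describes (describes (proj₂ (proj₂ split) , λ o → avoid (Occurs-◂◂⁺ x≤y (inj₁ o))))

  slot′ : ∀ v → ¬ Blocked (x ◂ y ◂ f) v → Slot ((x , y) ∷ r) v
  slot′ v ok with ≤-<-connex v x | ≤-<-connex v y
  ... | inj₁ v≤x | _        = inj₁ (v≤x , slot (λ b → ok (blocked-low x≤y v≤x b)))
  ... | inj₂ _   | inj₂ y<v = inj₂ y<v
  ... | inj₂ x<v | inj₁ v≤y = contradiction (blocked-middle pred-y x<v v≤y) ok

-- Both `x` and `y` are slots, so no 2143 arises, and `start≤peak` turns `lastPeak r < y` into the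
-- descent.
Valid-◂◂ : ∀ {n} {r : Pairs n} {f x y} → Describes r f → IsWord ((x , y) ∷ r) → Valid f → Valid (x ◂ y ◂ f)
Valid-◂◂ {r = r} {f} {x} {y} d (_ , x≤y , peak<y , _ , sx) (alt , avoid) =
  Alt-◂◂⁺ x≤y (≤-<-trans start≤peak peak<y) alt , λ o → none (Occurs-◂◂⁻ x≤y o)
  where
  open Describes d
  none : ¬ (Occurs f ⊎ Blocked f x ⊎ Blocked f y)
  none (inj₁ o)        = avoid o
  none (inj₂ (inj₁ b)) = free sx b
  none (inj₂ (inj₂ b)) = free (slot-above r peak<y) b

toWord-describes : ∀ n w → Valid (val w) → Describes (toWord n w) (val w)
toWord-describes zero w _ = record
  { isWord     = tt
  ; free       = λ { _ (0F , 0F , _ , (() , _) , _) }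
  ; slot       = λ _ → tt
  ; start≤peak = hd≤ w
  ; peak<slot  = λ w0<v _ → ≤-trans z<s w0<v
  }
toWord-describes (suc n) u valid = Describes-≗ (sym ∘ val-◂◂ u)
  (Describes-∷ (hd≤ (tl u)) (pred-attained (tl (tl u)) (hd≤ (tl u))) (Valid-≗ (val-◂◂ u) valid)
    (toWord-describes n (tl (tl u))))

toWord-cong : ∀ n {u w} → val u ≗ val w → toWord n u ≡ toWord n w
toWord-cong zero    eq = refl
toWord-cong (suc n) {u} {w} eq = cong₂ _∷_ (cong₂ _,_ (eq zero) (eq′ zero))
  (toWord-cong n (tl-cong (tl u) (tl w) eq′))
  where
  eq′ = tl-cong u w eq

toWord-injective : ∀ n {u w} → toWord n u ≡ toWord n w → val u ≗ val w
toWord-injective zero {u} {w} _ 0F = trans (n≤0⇒n≡0 (hd≤ u)) (sym (n≤0⇒n≡0 (hd≤ w)))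
toWord-injective (suc n) {u} {w} eq = ext u w (cong proj₁ heads)
  (ext (tl u) (tl w) (cong proj₂ heads) (toWord-injective n (proj₂ (∷-injective eq))))
  where
  heads = proj₁ (∷-injective eq)

toWord-surjective : ∀ n r → IsWord r → ∃[ w ] (Valid (val w) × toWord n w ≡ r)
toWord-surjective zero [] _ = Perm.id , (alt , avoid) , refl
  where
  alt : Alt {1} (val Perm.id)
  alt 0F 0F ()
  avoid : ¬ Occurs {1} (val Perm.id)
  avoid (0F , 0F , _ , _ , (() , _) , _)
toWord-surjective (suc n) ((x , y) ∷ r) g@(h , x≤y , _ , y≤ , _) =
  u , Valid-≗ (sym ∘ val-u) (Valid-◂◂ (subst (λ r → Describes r (val w)) w≡ (toWord-describes n w valid)) g valid) ,
  cong₂ _∷_ (cong₂ _,_ (hd-cons x≤ u₁) (trans (tl-cons x≤ u₁ zero) (hd-cons y≤ w)))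
    (trans (toWord-cong n λ i → trans (tl-cong (tl u) u₁ (tl-cons x≤ u₁) i) (tl-cons y≤ w i)) w≡)
  where
  IH = toWord-surjective n r h
  w = proj₁ IH
  valid = proj₁ (proj₂ IH)
  w≡ = proj₂ (proj₂ IH)
  x≤ = m≤n⇒m≤1+n (≤-trans x≤y y≤)
  u₁ = cons y≤ w
  u = cons x≤ u₁
  val-u : val u ≗ x ◂ y ◂ val w
  val-u i = trans (val-cons x≤ u₁ i) (◂-cong x (val-cons y≤ w) i)

permutations↔codes : ∀ n → Inverse (A (oddLength n) p2143) (codes n)
permutations↔codes n = mkInverse {S = A (oddLength n) p2143} {T = codes n}
  (λ s → toCode (word s) , toCode-isCode (word s) (isWord s))
  (λ eq → cong toCode (toWord-cong n λ i → cong toℕ (eq i)))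
  (λ {s} {t} eq i → toℕ-injective (toWord-injective n (toCode-injective _ _ (isWord s) (isWord t) eq) i))
  (λ (c , g) → let r , h , r≡ = toCode-surjective c g
                   w , (alt , avoid) , w≡ = toWord-surjective n r h in
    (w , alt , λ o → avoid (Contains⇒Occurs w o)) , trans (cong toCode w≡) r≡)
  where
  open Setoid (A (oddLength n) p2143) using (Carrier)
  word : Carrier → Pairs n
  word (w , _) = toWord n w
  isWord : ∀ s → IsWord (word s)
  isWord (w , alt , avoid) = Describes.isWord
    (toWord-describes n w (alt , λ o → avoid (Occurs⇒Contains w o)))

-- Tableaux built column by column

cells : ℕ → ℕ
cells zero    = 3
cells (suc n) = 3 + cells n

shift : ∀ {m} → Fin m → Fin (3 + m)
shift k = suc (suc (suc k))

end₀ : ∀ n → Fin (cells n)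
end₀ zero    = 1F
end₀ (suc n) = 2F

end₁ : ∀ n → Fin (cells n)
end₁ zero    = 0F
end₁ (suc n) = 1F

-- Boxes are numbered column by column from the right, each column from bottom to
-- top; end₀ and end₁ are the right ends of the first and the second row.  As the
-- bottom entry of the last column is the largest, no condition on the third row
-- of the remaining tableau is needed.
Std : ∀ n → (Fin (cells n) → ℕ) → Set
Std zero    e = e 2F < e 1F × e 1F < e 0F
Std (suc n) e = Std n (e ∘ shift) × e 2F < e 1F × e (shift (end₀ n)) < e 2F ×
                e (shift (end₁ n)) < e 1F × (∀ k → e (suc k) < e 0F)

Std-⊑ : ∀ n {e f} → e ⊑ f → Std n e → Std n f
Std-⊑ zero    e⊑f (a , b)             = e⊑f _ _ a , e⊑f _ _ b
Std-⊑ (suc n) e⊑f (s , a , b , c , d) =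
  Std-⊑ n (λ i j → e⊑f (shift i) (shift j)) s , e⊑f _ _ a , e⊑f _ _ b , e⊑f _ _ c , λ k → e⊑f _ _ (d k)

-- The entries `p` (top) and `q` (middle) are inserted in this order. When `q` arrives, the second
-- row ends in `up p (f (end₁ n))`; given `p < q`, this is below `q` iff `suc (f (end₁ n)) < q`, a
-- bound independent of `p`.
ColumnFits : ∀ n → (q p : ℕ) → (Fin (cells n) → ℕ) → Set
ColumnFits n q p f = p < q × f (end₀ n) < p × suc (f (end₁ n)) < q

up-≤⁺ : ∀ {v c t} → c < t → up v c ≤ t
up-≤⁺ {v} c<t = ≮⇒≥ λ t<up → <⇒≱ c<t (up->⁻ {v} t<up)

up-≤⁻ : ∀ {v c t} → v ≤ t → up v c ≤ t → c < t
up-≤⁻ v≤t up≤t = ≰⇒> λ t≤c → <⇒≱ (up->⁺ v≤t t≤c) up≤t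

Std-◂◂◂⁻ : ∀ n {r q p f} → Std (suc n) (r ◂ q ◂ p ◂ f) →
           Std n f × ColumnFits n q p f × (∀ k → (q ◂ p ◂ f) k < r)
Std-◂◂◂⁻ n {r} {q} {p} {f} (s , pq , fp , fq , max) =
  Std-⊑ n (λ i j → up-cancel-< p ∘ up-cancel-< q ∘ up-cancel-< r) s ,
  (p<q , up-<⁻ {p} (up-cancel-< q (up-cancel-< r fp)) , fits p<q (up-<⁻ {q} (up-cancel-< r fq))) ,
  λ k → up-<⁻ {r} (max k)
  where
  p<q : p < q
  p<q = up-<⁻ {q} (up-cancel-< r pq)
  fits : ∀ {q} → p < q → up p (f (end₁ n)) < q → suc (f (end₁ n)) < q
  fits (s≤s p≤) (s≤s up≤) = s≤s (up-≤⁻ p≤ up≤)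

Std-◂◂◂⁺ : ∀ n {r q p f} → Std n f → ColumnFits n q p f → (∀ k → (q ◂ p ◂ f) k < r) →
           Std (suc n) (r ◂ q ◂ p ◂ f)
Std-◂◂◂⁺ n {r} {q} {p} {f} s (p<q , fp , fq) max =
  Std-⊑ n (λ i j → up-mono-< r ∘ up-mono-< q ∘ up-mono-< p) s ,
  up-mono-< r (up-<⁺ ≤-refl p<q) ,
  up-mono-< r (up-mono-< q (up-<⁺ ≤-refl fp)) ,
  up-mono-< r (up-<⁺ ≤-refl (fits fq)) ,
  λ k → up-<⁺ ≤-refl (max k)
  where
  fits : ∀ {q} → suc (f (end₁ n)) < q → up p (f (end₁ n)) < q
  fits (s≤s fq) = s≤s (up-≤⁺ {p} fq)

descending : ∀ {a b c} → c < b → b < a → a ≤ 2 → a ≡ 2 × b ≡ 1 × c ≡ 0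
descending (s≤s z≤n) (s≤s (s≤s z≤n)) (s≤s (s≤s z≤n)) = refl , refl , refl

Std-zero : ∀ {e : Fin 3 → ℕ} → Std 0 e → e 0F ≤ 2 → e 0F ≡ 2 × e 1F ≡ 1 × e 2F ≡ 0
Std-zero (2<1 , 1<0) = descending 2<1 1<0

-- The coordinates count the old entries that exceed the top and the middle entry of the last
-- column. The bottom entry is forced, see `Std-hd`.
toTableauCode : ∀ n → Permutation′ (cells n) → Pairs n
toTableauCode zero    π = []
toTableauCode (suc n) π =
  (cells n ∸ hd (tl (tl π)) , suc (cells n) ∸ hd (tl π)) ∷ toTableauCode n (tl (tl (tl π)))

-- The equations say that `pMax c` and `qMax c` are the numbers of entries exceeding the right ends
-- of the first two rows.
record Labels {n} (c : Pairs n) (f : Fin (cells n) → ℕ) : Set where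
  field
    isCode : IsCode c
    label₀ : pMax c + suc (f (end₀ n)) ≡ cells n
    label₁ : qMax c + suc (f (end₁ n)) ≡ cells n

Labels-≗ : ∀ {n} {c : Pairs n} {f g} → f ≗ g → Labels c f → Labels c g
Labels-≗ {n} {c} eq l = record
  { isCode = isCode
  ; label₀ = trans (cong (λ v → pMax c + suc v) (sym (eq (end₀ n)))) label₀
  ; label₁ = trans (cong (λ v → qMax c + suc v) (sym (eq (end₁ n)))) label₁
  }
  where open Labels l

module _ {n : ℕ} {c : Pairs n} {f : Fin (cells n) → ℕ} (labels : Labels c f) where
  private
    N = cells n
  open Labels labels

  -- Besides old entries, `q` and `r` exceed `p`, and `r` exceeds `q`: hence the increments 2 and 1
  -- in `pMax` and `qMax`. The bounds on the code are `ColumnFits` counted from the top.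
  Labels-◂◂◂ : ∀ {r q p} → p ≤ N → q ≤ suc N → ColumnFits n q p f → (∀ k → (q ◂ p ◂ f) k < r) →
               Labels ((N ∸ p , suc N ∸ q) ∷ c) (r ◂ q ◂ p ◂ f)
  Labels-◂◂◂ {r} {q} {p} p≤ q≤ (p<q , fp , fq) max = record
    { isCode = isCode , q̂≤ , ∸-monoʳ-≤ (suc N) p<q , p̂≤
    ; label₀ = trans (cong (λ v → 2 + (N ∸ p) + suc v) p≡) (cong (2 +_) (trans (+-suc (N ∸ p) p) (cong suc (m∸n+n≡m p≤))))
    ; label₁ = trans (cong (λ v → suc (suc N ∸ q) + suc v) q≡) (cong suc (trans (+-suc (suc N ∸ q) q) (cong suc (m∸n+n≡m q≤))))
    }
    where
    p≡ : up r (up q p) ≡ p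
    p≡ = trans (up-lower r (max 1F)) (up-lower q p<q)
    q≡ : up r q ≡ q
    q≡ = up-lower r (max 0F)
    p̂≤ : N ∸ p ≤ pMax c
    p̂≤ = ≤-trans (∸-monoʳ-≤ N fp) (≤-reflexive (trans (cong (_∸ suc (f (end₀ n))) (sym label₀)) (m+n∸n≡m (pMax c) (suc (f (end₀ n))))))
    q̂≤ : suc N ∸ q ≤ qMax c
    q̂≤ = ≤-trans (∸-monoʳ-≤ (suc N) fq) (≤-reflexive (trans (cong (_∸ suc (f (end₁ n))) (sym label₁)) (m+n∸n≡m (qMax c) (suc (f (end₁ n))))))

  IsCode⇒ColumnFits : ∀ {p̂ q̂} → IsCode ((p̂ , q̂) ∷ c) → p̂ < N × q̂ < N × ColumnFits n (suc N ∸ q̂) (N ∸ p̂) f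
  IsCode⇒ColumnFits {p̂} {q̂} (_ , q̂≤ , q̂≤p̂ , p̂≤) =
    <-of p̂≤ label₀ , q̂<N ,
    ≤-trans (s≤s (∸-monoʳ-≤ N q̂≤p̂)) (≤-reflexive (sym (+-∸-assoc 1 (<⇒≤ q̂<N)))) ,
    m+n≤o⇒m≤o∸n _ (bound p̂≤ label₀) ,
    m+n≤o⇒m≤o∸n _ (s≤s (bound q̂≤ label₁))
    where
    bound : ∀ {a b d} → a ≤ b → b + suc d ≡ N → suc d + a ≤ N
    bound {a} {b} {d} a≤b eq = ≤-trans (+-monoʳ-≤ (suc d) a≤b) (≤-reflexive (trans (+-comm (suc d) b) eq))
    <-of : ∀ {a b d} → a ≤ b → b + suc d ≡ N → a < N
    <-of {a} {b} {d} a≤b eq = ≤-trans (s≤s (m≤n+m a d)) (bound a≤b eq)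
    q̂<N : q̂ < N
    q̂<N = <-of q̂≤ label₁

val-◂◂◂ : ∀ {m} (π : Permutation′ (3 + m)) → val π ≗ hd π ◂ hd (tl π) ◂ hd (tl (tl π)) ◂ val (tl (tl (tl π)))
val-◂◂◂ π i = trans (val-◂ π i) (◂-cong (hd π) (λ j →
  trans (val-◂ (tl π) j) (◂-cong (hd (tl π)) (val-◂ (tl (tl π))) j)) i)

Std-tl : ∀ n π → Std (suc n) (val π) → let q = hd (tl π) ; p = hd (tl (tl π)) ; f = val (tl (tl (tl π))) in
         Std n f × ColumnFits n q p f × (∀ k → (q ◂ p ◂ f) k < hd π)
Std-tl n π s = Std-◂◂◂⁻ n (Std-⊑ (suc n) (≗⇒⊑ (val-◂◂◂ π)) s)

toTableauCode-labels : ∀ n π → Std n (val π) → Labels (toTableauCode n π) (val π)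
toTableauCode-labels zero π s = record
  { isCode = tt
  ; label₀ = cong (2 +_) (proj₁ (proj₂ values))
  ; label₁ = cong suc (proj₁ values)
  }
  where
  values = Std-zero {val π} s (hd≤ π)
toTableauCode-labels (suc n) π s = Labels-≗ (sym ∘ val-◂◂◂ π)
  (Labels-◂◂◂ (toTableauCode-labels n (tl (tl (tl π))) (proj₁ split)) (hd≤ (tl (tl π))) (hd≤ (tl π))
    (proj₁ (proj₂ split)) (proj₂ (proj₂ split)))
  where
  split = Std-tl n π s

hd-max : ∀ {m} (π : Permutation′ (suc m)) → (∀ k → val (tl π) k < hd π) → hd π ≡ m
hd-max {zero}  π max = n≤0⇒n≡0 (hd≤ π)
hd-max {suc m} π max = ≤-antisym (hd≤ π)
  (let k , eq = val-surjective (tl π) (n<1+n m) in subst (_< hd π) eq (max k))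

Std-hd : ∀ n π → Std (suc n) (val π) → hd π ≡ 2 + cells n
Std-hd n π (_ , _ , _ , _ , max) = hd-max π λ k →
  up-<⁻ {hd π} (subst (_< hd π) (val-◂ π (suc k)) (max k))

toTableauCode-cong : ∀ n {π ρ} → val π ≗ val ρ → toTableauCode n π ≡ toTableauCode n ρ
toTableauCode-cong zero    eq = refl
toTableauCode-cong (suc n) {π} {ρ} eq = cong₂ _∷_
  (cong₂ _,_ (cong (cells n ∸_) (eq₂ zero)) (cong (suc (cells n) ∸_) (eq₁ zero)))
  (toTableauCode-cong n (tl-cong (tl (tl π)) (tl (tl ρ)) eq₂))
  where
  eq₁ = tl-cong π ρ eq
  eq₂ = tl-cong (tl π) (tl ρ) eq₁

toTableauCode-injective : ∀ n {π ρ} → Std n (val π) → Std n (val ρ) →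
                          toTableauCode n π ≡ toTableauCode n ρ → val π ≗ val ρ
toTableauCode-injective zero {π} {ρ} s t _ = λ where
    0F → trans (proj₁ vπ) (sym (proj₁ vρ))
    1F → trans (proj₁ (proj₂ vπ)) (sym (proj₁ (proj₂ vρ)))
    2F → trans (proj₂ (proj₂ vπ)) (sym (proj₂ (proj₂ vρ)))
  where
  vπ = Std-zero {val π} s (hd≤ π)
  vρ = Std-zero {val ρ} t (hd≤ ρ)
toTableauCode-injective (suc n) {π} {ρ} s t eq =
  ext π ρ (trans (Std-hd n π s) (sym (Std-hd n ρ t)))
    (ext (tl π) (tl ρ) (∸-cancelˡ-≡ (hd≤ (tl π)) (hd≤ (tl ρ)) (cong proj₂ heads))
      (ext (tl (tl π)) (tl (tl ρ)) (∸-cancelˡ-≡ (hd≤ (tl (tl π))) (hd≤ (tl (tl ρ))) (cong proj₁ heads))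
        (toTableauCode-injective n (proj₁ (Std-tl n π s)) (proj₁ (Std-tl n ρ t)) (proj₂ (∷-injective eq)))))
  where
  heads = proj₁ (∷-injective eq)

toTableauCode-surjective : ∀ n c → IsCode c → ∃[ π ] (Std n (val π) × toTableauCode n π ≡ c)
-- Boxes run from right to left, so the only tableau of shape ⟨2,1⟩ reads 2, 1, 0.
toTableauCode-surjective zero [] _ = Perm.reverse , (s≤s z≤n , s≤s (s≤s z≤n)) , refl
toTableauCode-surjective (suc n) ((p̂ , q̂) ∷ c) g =
  π , Std-⊑ (suc n) (≗⇒⊒ val-π) (Std-◂◂◂⁺ n (proj₁ (proj₂ IH)) (proj₂ (proj₂ fit)) max) ,
  cong₂ _∷_
    (cong₂ _,_ (trans (cong (cells n ∸_) (trans (tl-tl zero) (hd-cons p≤ ρ))) (m∸[m∸n]≡n (<⇒≤ (proj₁ fit))))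
               (trans (cong (suc (cells n) ∸_) (trans (tl-π zero) (hd-cons q≤ π₂))) (m∸[m∸n]≡n (m≤n⇒m≤1+n (<⇒≤ (proj₁ (proj₂ fit)))))))
    (trans (toTableauCode-cong n λ i → trans (tl-cong (tl (tl π)) π₂ tl-tl i) (tl-cons p≤ ρ i)) (proj₂ (proj₂ IH)))
  where
  IH = toTableauCode-surjective n c (proj₁ g)
  ρ = proj₁ IH
  fit = IsCode⇒ColumnFits (subst (λ c → Labels c (val ρ)) (proj₂ (proj₂ IH)) (toTableauCode-labels n ρ (proj₁ (proj₂ IH)))) g
  p≤ : cells n ∸ p̂ ≤ cells n
  p≤ = m∸n≤m (cells n) p̂
  q≤ : suc (cells n) ∸ q̂ ≤ suc (cells n)
  q≤ = m∸n≤m (suc (cells n)) q̂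
  π₂ = cons p≤ ρ
  π₁ = cons q≤ π₂
  -- The bottom entry is the largest possible letter, `2 + cells n`.
  π  = cons ≤-refl π₁
  tl-π : val (tl π) ≗ val π₁
  tl-π = tl-cons ≤-refl π₁
  tl-tl : val (tl (tl π)) ≗ val π₂
  tl-tl i = trans (tl-cong (tl π) π₁ tl-π i) (tl-cons q≤ π₂ i)
  val-π₁ : val π₁ ≗ (suc (cells n) ∸ q̂) ◂ (cells n ∸ p̂) ◂ val ρ
  val-π₁ i = trans (val-cons q≤ π₂ i) (◂-cong _ (val-cons p≤ ρ) i)
  val-π : val π ≗ (2 + cells n) ◂ (suc (cells n) ∸ q̂) ◂ (cells n ∸ p̂) ◂ val ρ
  val-π i = trans (val-cons ≤-refl π₁ i) (◂-cong _ val-π₁ i)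
  max : ∀ k → ((suc (cells n) ∸ q̂) ◂ (cells n ∸ p̂) ◂ val ρ) k < 2 + cells n
  max k = subst (_< 2 + cells n) (val-π₁ k) (toℕ<n (π₁ ⟨$⟩ʳ k))

-- The boxes of the shape, measured from the right

-- Recursion on `n` lengthens all rows at once, which is the adding of a column.
rowLength : ℕ → Fin 3 → ℕ
rowLength zero    0F = 2
rowLength zero    1F = 1
rowLength zero    2F = 0
rowLength (suc n) i  = suc (rowLength n i)

lastColumn : ∀ {m} → Fin 3 → Fin (3 + m)
lastColumn 0F = 2F
lastColumn 1F = 1F
lastColumn 2F = 0F

-- Here d is the distance from the right end of row i.
index : ∀ n i → Fin (rowLength n i) → Fin (cells n)
index zero    0F 0F      = 1F
index zero    0F 1F      = 2F
index zero    1F 0F      = 0F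
index zero    2F ()
index (suc n) i  zero    = lastColumn i
index (suc n) i  (suc d) = shift (index n i d)

cell : ∀ n → Fin (cells n) → ∃[ i ] Fin (rowLength n i)
cell zero    0F                  = 1F , 0F
cell zero    1F                  = 0F , 0F
cell zero    2F                  = 0F , 1F
cell (suc n) 0F                  = 2F , zero
cell (suc n) 1F                  = 1F , zero
cell (suc n) 2F                  = 0F , zero
cell (suc n) (suc (suc (suc k))) = map₂ suc (cell n k)

index-cell : ∀ n k → uncurry (index n) (cell n k) ≡ k
index-cell zero    0F                  = refl
index-cell zero    1F                  = refl
index-cell zero    2F                  = refl
index-cell (suc n) 0F                  = refl
index-cell (suc n) 1F                  = refl
index-cell (suc n) 2F                  = refl
index-cell (suc n) (suc (suc (suc k))) = cong shift (index-cell n k)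

cell-index : ∀ n i d → cell n (index n i d) ≡ (i , d)
cell-index zero    0F 0F      = refl
cell-index zero    0F 1F      = refl
cell-index zero    1F 0F      = refl
cell-index zero    2F ()
cell-index (suc n) 0F zero    = refl
cell-index (suc n) 1F zero    = refl
cell-index (suc n) 2F zero    = refl
cell-index (suc n) i  (suc d) = cong (map₂ suc) (cell-index n i d)

-- All three rows end in the same column, so equal distances from the right mean equal columns, and
-- a smaller distance means further right.
record Increasing n (f : Fin (cells n) → ℕ) : Set where
  field
    rows    : ∀ i {d d′} → d′ Fin.< d → f (index n i d) < f (index n i d′)
    columns : ∀ {i i′ d d′} → i Fin.< i′ → toℕ d ≡ toℕ d′ → f (index n i d) < f (index n i′ d′)

≤end₀ : ∀ n {f} → Increasing n f → ∀ d → f (index n 0F d) ≤ f (end₀ n)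
≤end₀ zero    _   0F      = ≤-refl
≤end₀ zero    inc 1F      = <⇒≤ (Increasing.rows inc 0F {1F} z<s)
≤end₀ (suc n) _   zero    = ≤-refl
≤end₀ (suc n) inc (suc d) = <⇒≤ (Increasing.rows inc 0F z<s)

≤end₁ : ∀ n {f} → Increasing n f → ∀ d → f (index n 1F d) ≤ f (end₁ n)
≤end₁ zero    _   0F      = ≤-refl
≤end₁ (suc n) _   zero    = ≤-refl
≤end₁ (suc n) inc (suc d) = <⇒≤ (Increasing.rows inc 1F z<s)

end₀-index : ∀ n → ∃[ d ] index n 0F d ≡ end₀ n
end₀-index zero    = 0F , refl
end₀-index (suc n) = zero , refl

end₁-index : ∀ n → ∃[ d ] index n 1F d ≡ end₁ n
end₁-index zero    = 0F , refl
end₁-index (suc n) = zero , refl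

Increasing⇒Std : ∀ n {f} → Increasing n f → Std n f
Increasing⇒Std zero    inc = rows 0F {1F} {0F} z<s , columns {0F} {1F} {0F} {0F} z<s refl
  where open Increasing inc
Increasing⇒Std (suc n) {f} inc =
  Increasing⇒Std n (record { rows = λ i → rows i ∘ s≤s ; columns = λ lt eq → columns lt (cong suc eq) }) ,
  columns {0F} {1F} {zero} {zero} z<s refl ,
  (let d , eq = end₀-index n in subst (λ k → f (shift k) < f 2F) eq (rows 0F {suc d} z<s)) ,
  (let d , eq = end₁-index n in subst (λ k → f (shift k) < f 1F) eq (rows 1F {suc d} z<s)) ,
  max
  where
  open Increasing inc
  last≤corner : ∀ i → f (lastColumn i) ≤ f 0F
  last≤corner 0F = <⇒≤ (columns {0F} {2F} {zero} {zero} z<s refl)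
  last≤corner 1F = <⇒≤ (columns {1F} {2F} {zero} {zero} (s≤s z<s) refl)
  last≤corner 2F = ≤-refl
  max : ∀ k → f (suc k) < f 0F
  max 0F            = columns {1F} {2F} {zero} {zero} (s≤s z<s) refl
  max 1F            = columns {0F} {2F} {zero} {zero} z<s refl
  -- An older entry is below the end of its row, which lies in the last column and is at most the
  -- corner.
  max (suc (suc k)) = let i , d = cell n k in
    <-≤-trans (subst (λ k → f (shift k) < f (lastColumn i)) (index-cell n k) (rows i {suc d} z<s)) (last≤corner i)

-- By induction the right end of an old row bounds that row, so in the first two rows comparing the
-- new entry with this end suffices; the corner exceeds everything.
Std⇒Increasing : ∀ n {f} → Std n f → Increasing n f
Std⇒Increasing zero {f} (2<1 , 1<0) = record { rows = rows ; columns = columns }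
  where
  rows : ∀ i {d d′} → d′ Fin.< d → f (index 0 i d) < f (index 0 i d′)
  rows 0F {1F} {0F} _ = 2<1
  rows 0F {1F} {1F} (s≤s ())
  rows 1F {0F} {0F} ()
  rows 2F {()}
  columns : ∀ {i i′ d d′} → i Fin.< i′ → toℕ d ≡ toℕ d′ → f (index 0 i d) < f (index 0 i′ d′)
  columns {0F} {1F} {0F} {0F} _ _ = 1<0
  columns {1F} {1F} (s≤s ())
  columns {2F} {d = ()}
  columns {i′ = 2F} {d′ = ()}
Std⇒Increasing (suc n) {f} (s , 2<1 , e₀ , e₁ , max) = record { rows = rows ; columns = columns }
  where
  IH = Std⇒Increasing n s
  rows : ∀ i {d d′} → d′ Fin.< d → f (index (suc n) i d) < f (index (suc n) i d′)
  rows i  {suc d} {suc d′} d′<d = Increasing.rows IH i (s≤s⁻¹ d′<d)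
  rows 0F {suc d} {zero}   _    = ≤-<-trans (≤end₀ n IH d) e₀
  rows 1F {suc d} {zero}   _    = ≤-<-trans (≤end₁ n IH d) e₁
  rows 2F {suc d} {zero}   _    = max _
  columns : ∀ {i i′ d d′} → i Fin.< i′ → toℕ d ≡ toℕ d′ → f (index (suc n) i d) < f (index (suc n) i′ d′)
  columns {d = suc d} {suc d′} i<i′ eq = Increasing.columns IH i<i′ (suc-injective eq)
  columns {0F} {1F} {zero} {zero} _ _ = 2<1
  columns {0F} {2F} {zero} {zero} _ _ = max _
  columns {1F} {2F} {zero} {zero} _ _ = max _
  columns {1F} {1F} {zero} {zero} (s≤s ())
  columns {2F} {1F} {zero} {zero} (s≤s ())
  columns {2F} {2F} {zero} {zero} (s≤s (s≤s ()))

shape : ℕ → StrictPartition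
shape = ⟨n+2,n+1,n⟩

rowLength-parts : ∀ n i → List.lookup (parts (shape n)) i ≡ rowLength n i
rowLength-parts zero    0F = refl
rowLength-parts zero    1F = refl
rowLength-parts zero    2F = refl
rowLength-parts (suc n) 0F = cong suc (rowLength-parts n 0F)
rowLength-parts (suc n) 1F = cong suc (rowLength-parts n 1F)
rowLength-parts (suc n) 2F = cong suc (rowLength-parts n 2F)

rowLength-sum : ∀ n i → rowLength n i + toℕ i ≡ 2 + n
rowLength-sum zero    0F = refl
rowLength-sum zero    1F = refl
rowLength-sum zero    2F = refl
rowLength-sum (suc n) i  = cong suc (rowLength-sum n i)

cells-size : ∀ n → cells n ≡ ∣ shape n ∣
cells-size zero    = refl
cells-size (suc n) = trans (cong (3 +_) (cells-size n)) (solve 1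
  (λ n → con 3 :+ ((con 2 :+ n) :+ ((con 1 :+ n) :+ (n :+ con 0))) :=
         (con 3 :+ n) :+ ((con 2 :+ n) :+ ((con 1 :+ n) :+ con 0))) refl n)
  where open +-*-Solver using (solve; con; _:+_; _:=_)

flip-row : ∀ n {i} → Fin (List.lookup (parts (shape n)) i) ↔ Fin (rowLength n i)
flip-row n {i} = Perm.cast-id (rowLength-parts n i) Perm.∘ₚ Perm.reverse

layout : ∀ n → Box (shape n) ↔ Fin (cells n)
layout n = mk↔ₛ′ to from to-from from-to
  where
  to : Box (shape n) → Fin (cells n)
  to (i , d) = index n i (flip-row n ⟨$⟩ʳ d)
  from : Fin (cells n) → Box (shape n)
  from k = map₂ (flip-row n ⟨$⟩ˡ_) (cell n k)
  to-from : ∀ k → to (from k) ≡ k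
  to-from k = trans (cong (index n (proj₁ (cell n k))) (Perm.inverseʳ (flip-row n))) (index-cell n k)
  from-to : ∀ b → from (to b) ≡ b
  from-to (i , d) = trans (cong (map₂ (flip-row n ⟨$⟩ˡ_)) (cell-index n i _)) (cong (i ,_) (Perm.inverseˡ (flip-row n)))

-- The last column has number `n + 1` in every row, so the distance from the right and the column
-- number are complementary; this reverses the order within rows and keeps columns together.
flip-row-sum : ∀ n {i} d → toℕ (flip-row n {i} ⟨$⟩ʳ d) + (toℕ i + toℕ d) ≡ suc n
flip-row-sum n {i} d = suc-injective (begin
  suc (toℕ (opposite e) + (toℕ i + toℕ d))           ≡⟨ cong (λ v → suc (v + (toℕ i + toℕ d))) (opposite-prop e) ⟩
  suc (rowLength n i ∸ suc (toℕ e) + (toℕ i + toℕ d)) ≡⟨ cong (λ v → suc (rowLength n i ∸ suc v + (toℕ i + toℕ d))) (toℕ-cast _ d) ⟩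
  suc (rowLength n i ∸ suc (toℕ d) + (toℕ i + toℕ d)) ≡⟨ cong (λ v → suc (rowLength n i ∸ suc (toℕ d) + v)) (+-comm (toℕ i) (toℕ d)) ⟩
  suc (rowLength n i ∸ suc (toℕ d) + (toℕ d + toℕ i)) ≡⟨ cong suc (+-assoc (rowLength n i ∸ suc (toℕ d)) (toℕ d) (toℕ i)) ⟨
  suc (rowLength n i ∸ suc (toℕ d) + toℕ d) + toℕ i   ≡⟨ cong (_+ toℕ i) (+-suc (rowLength n i ∸ suc (toℕ d)) (toℕ d)) ⟨
  rowLength n i ∸ suc (toℕ d) + suc (toℕ d) + toℕ i   ≡⟨ cong (_+ toℕ i) (m∸n+n≡m d<) ⟩
  rowLength n i + toℕ i                               ≡⟨ rowLength-sum n i ⟩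
  2 + n                                               ∎)
  where
  open ≡-Reasoning
  e = cast (rowLength-parts n i) d
  d< : toℕ d < rowLength n i
  d< = subst (toℕ d <_) (rowLength-parts n i) (toℕ<n d)

sum-flip-< : ∀ {a b c d s : ℕ} → a + b ≡ s → c + d ≡ s → b < d → c < a
sum-flip-< {a} {b} {c} {d} refl eq b<d = ≰⇒> λ a≤c →
  <⇒≢ (+-mono-≤-< a≤c b<d) (sym eq)

sum-flip-≡ : ∀ {a b c d s : ℕ} → a + b ≡ s → c + d ≡ s → b ≡ d → a ≡ c
sum-flip-≡ {a} {b} {c} refl eq refl = sym (+-cancelʳ-≡ b c a eq)

unflip-row-sum : ∀ n {i} d → (toℕ i + toℕ (flip-row n {i} ⟨$⟩ˡ d)) + toℕ d ≡ suc n
unflip-row-sum n {i} d = trans (+-comm _ (toℕ d)) (trans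
  (cong (λ e → toℕ e + (toℕ i + toℕ (flip-row n {i} ⟨$⟩ˡ d))) (sym (Perm.inverseʳ (flip-row n {i}))))
  (flip-row-sum n (flip-row n {i} ⟨$⟩ˡ d)))

-- Tableaux as permutations

reading : ∀ n → ShiftedSYT (shape n) → Permutation′ (cells n)
reading n T = Perm.cast-id (sym (cells-size n)) ↔-∘ (ShiftedSYT.filling T ↔-∘ ↔-sym (layout n))

val-reading : ∀ n T k → val (reading n T) k ≡ toℕ (entry T (Inverse.from (layout n) k))
val-reading n T k = toℕ-cast (sym (cells-size n)) _

reading-increasing : ∀ n T → Increasing n (val (reading n T))
reading-increasing n T = record
  { rows    = λ i {d} {d′} d′<d → subst₂ _<_ (sym (val-index i d)) (sym (val-index i d′))
      (ShiftedSYT.rowsIncrease T _ _ refl (sum-flip-< (unflip-row-sum n {i} d′) (unflip-row-sum n {i} d) d′<d))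
  ; columns = λ {i} {i′} {d} {d′} i<i′ d≡d′ → subst₂ _<_ (sym (val-index i d)) (sym (val-index i′ d′))
      (ShiftedSYT.columnsIncrease T _ _ (sum-flip-≡ (unflip-row-sum n {i} d) (unflip-row-sum n {i′} d′) d≡d′) i<i′)
  }
  where
  val-index : ∀ i d → val (reading n T) (index n i d) ≡ toℕ (entry T (i , flip-row n ⟨$⟩ˡ d))
  val-index i d = trans (val-reading n T (index n i d))
    (cong (λ c → toℕ (entry T (map₂ (flip-row n ⟨$⟩ˡ_) c))) (cell-index n i d))

tableau : ∀ n (π : Permutation′ (cells n)) → Increasing n (val π) → ShiftedSYT (shape n)
tableau n π inc = record
  { filling         = Perm.cast-id (cells-size n) ↔-∘ (π ↔-∘ layout n)
  -- The types of `d` and `d′` depend on the rows, so the equality of row numbers is first made an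
  -- equality of indices that can be matched.
  ; rowsIncrease    = λ (i , d) (i′ , d′) i≡i′ lt → rowsIncrease i i′ d d′ (toℕ-injective i≡i′) lt
  ; columnsIncrease = λ (i , d) (i′ , d′) eq i<i′ → subst₂ _<_ (sym (toℕ-cast (cells-size n) _)) (sym (toℕ-cast (cells-size n) _))
      (columns i<i′ (sum-flip-≡ (flip-row-sum n {i} d) (flip-row-sum n {i′} d′) eq))
  }
  where
  open Increasing inc
  filled : ∀ {i} → Fin (List.lookup (parts (shape n)) i) → ℕ
  filled {i} d = toℕ (cast (cells-size n) (π ⟨$⟩ʳ index n i (flip-row n ⟨$⟩ʳ d)))
  rowsIncrease : ∀ i i′ d d′ → i ≡ i′ → toℕ i + toℕ d < toℕ i′ + toℕ d′ → filled {i} d < filled {i′} d′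
  rowsIncrease i i d d′ refl lt = subst₂ _<_ (sym (toℕ-cast (cells-size n) _)) (sym (toℕ-cast (cells-size n) _))
    (rows i (sum-flip-< (flip-row-sum n {i} d) (flip-row-sum n {i} d′) lt))

reading-tableau : ∀ n π inc → val (reading n (tableau n π inc)) ≗ val π
reading-tableau n π inc k = trans (val-reading n (tableau n π inc) k)
  (trans (toℕ-cast (cells-size n) _) (cong (val π) (Inverse.strictlyInverseˡ (layout n) k)))

tableaux↔codes : ∀ n → Inverse (shiftedSYT (shape n)) (codes n)
tableaux↔codes n = mkInverse {S = shiftedSYT (shape n)} {T = codes n}
  (λ T → toTableauCode n (reading n T) , Labels.isCode (toTableauCode-labels n (reading n T) (standard T)))
  (λ {T} {U} eq → toTableauCode-cong n {reading n T} {reading n U} λ k →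
    trans (val-reading n T k) (trans (cong toℕ (eq _)) (sym (val-reading n U k))))
  (λ {T} {U} eq b → toℕ-injective (begin
    toℕ (entry T b)                      ≡⟨ entry-reading T b ⟨
    val (reading n T) (position b)       ≡⟨ toTableauCode-injective n (standard T) (standard U) eq (position b) ⟩
    val (reading n U) (position b)       ≡⟨ entry-reading U b ⟩
    toℕ (entry U b)                      ∎))
  (λ (c , g) → let π , s , π≡ = toTableauCode-surjective n c g
                   inc = Std⇒Increasing n s in
    tableau n π inc , trans (toTableauCode-cong n (reading-tableau n π inc)) π≡)
  where
  open ≡-Reasoning
  standard : ∀ T → Std n (val (reading n T))
  standard T = Increasing⇒Std n (reading-increasing n T)
  position : Box (shape n) → Fin (cells n)
  position = Inverse.to (layout n)
  entry-reading : ∀ T b → val (reading n T) (position b) ≡ toℕ (entry T b)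
  entry-reading T b = trans (val-reading n T (position b)) (cong (toℕ ∘ entry T) (Inverse.strictlyInverseʳ (layout n) b))

-- Comparison of the two sizes

oddLength-≡ : ∀ n → oddLength n ≡ 2 * n + 1
oddLength-≡ n = trans (cong suc (go n)) (+-comm 1 (2 * n))
  where
  go : ∀ n → double n ≡ 2 * n
  go zero    = refl
  go (suc n) = trans (cong (2 +_) (go n)) (sym (*-suc 2 n))

mainTheorem2 : ∀ (n : ℕ) → ∃[ k ] (HasSize (A (2 * n + 1) p2143) k × HasSize (shiftedSYT (⟨n+2,n+1,n⟩ n)) k)
mainTheorem2 n = k ,
  subst (λ m → HasSize (A m p2143) k) (oddLength-≡ n) (Composition.inverse (permutations↔codes n) enumeration) ,
  Composition.inverse (tableaux↔codes n) enumeration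
  where
  -- The common size is the number of codes of length `n`.
  k = List.length (allCodes n)
  enumeration : HasSize (codes n) k
  enumeration = Symmetry.inverse (codes-enumeration n)
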